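{- Let $p$ be a selective ultrafilter on $\omega$. Then every element $u$ of $\mathscr G^p$ generates a free subsemigroup of $\beta\omega$, i.e. for all $n,m\in\mathbb N$, $u^n=u^m$ iff $n=m$ (this is for nonprincipal $u$). In particular, no element of $\mathscr G^p$ is an idempotent ultrafilter (a nonprincipal $u$ with $u+u=u$).
   Context: $\beta\omega$ is the set of ultrafilters on $\omega$, $\mathbb N=\{1,2,\dots\}$. For $u,v\in\beta\omega$, $u+v=\{A\subseteq\omega : \{x : \{y : x+y\in A\}\in v\}\in u\}$ and $u^n=u+\cdots+u$ ($n$ summands). A nonprincipal ultrafilter $p$ on $\omega$ is selective if for every partition $\omega=\bigcup_{n<\omega}X_n$ either some $X_n\in p$ or there is $A\in p$ with $|A\cap X_n|\le1$ for all $n$. For ultrafilters $u,u_n$ ($n<\omega$), the $u$-limit $u\text{ - }\lim_n u_n$ is the ultrafilter $\{A : \{n : A\in u_n\}\in u\}$. For $p\in\beta\omega$ define $\mathscr G^p_1$ = the set of principal ultrafilters on $\omega$, $\mathscr G^p_{\alpha+1}=\{p\text{ - }\lim_n u_n : u_n\in\mathscr G^p_\alpha \text{ for all } n\}$, $\mathscr G^p_\alpha=\bigcup_{\xi<\alpha}\mathscr G^p_\xi$ for limit $\alpha$, and $\mathscr G^p=\bigcup_{\alpha\ge1}\mathscr G^p_\alpha$. -}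

module Defs where

open import Data.Nat using (ℕ; zero; suc; _+_)
open import Data.Product using (Σ; _×_; _,_)
open import Data.Sum using (_⊎_)
open import Data.Empty using (⊥)
open import Data.Unit using (⊤)
open import Relation.Nullary using (¬_)
open import Relation.Binary.PropositionalEquality using (_≡_)

Subset : Set₁
Subset = ℕ → Set

Filt : Set₁
Filt = Subset → Set

_⊆_ : Subset → Subset → Set
A ⊆ B = ∀ x → A x → B x

_∩_ : Subset → Subset → Subset
(A ∩ B) x = A x × B x

∁ : Subset → Subset
∁ A x = ¬ A x

record IsUltrafilter (u : Filt) : Set₁ where
  field
    upward  : ∀ A B → A ⊆ B → u A → u B
    inter   : ∀ A B → u A → u B → u (A ∩ B)
    full    : u (λ _ → ⊤)
    proper  : ¬ u (λ _ → ⊥)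
    ultra   : ∀ A → u A ⊎ u (∁ A)

singleton : ℕ → Subset
singleton k x = x ≡ k

principal : ℕ → Filt
principal k A = A k

NonPrincipal : Filt → Set
NonPrincipal u = ¬ (Σ ℕ λ k → u (singleton k))

_≈_ : Filt → Filt → Set₁
u ≈ v = ∀ A → (u A → v A) × (v A → u A)

_⊕_ : Filt → Filt → Filt
(u ⊕ v) A = u (λ x → v (λ y → A (x + y)))

-- u ^ n : n-fold sum (u ^ 0 = principal 0, the identity; u ^ 1 ≈ u)
_^_ : Filt → ℕ → Filt
u ^ zero = principal 0
u ^ suc n = u ⊕ (u ^ n)

lim : Filt → (ℕ → Filt) → Filt
lim u us A = u (λ n → us n A)

-- selective ultrafilter; a partition ω = ⋃ X_n is a family of
-- pairwise disjoint sets covering ω (pieces may be empty)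
record Selective (p : Filt) : Set₁ where
  field
    isUltra     : IsUltrafilter p
    nonPrincipal : NonPrincipal p
    select : (X : ℕ → Subset)
           → (∀ x → Σ ℕ λ n → X n x)
           → (∀ x n m → X n x → X m x → n ≡ m)
           → (Σ ℕ λ n → p (X n))
             ⊎ (Σ Subset λ A → p A × (∀ n x y → A x → X n x → A y → X n y → x ≡ y))

-- Well-founded trees coding the construction of elements of 𝒢^p:
-- a leaf k is the principal ultrafilter at k (level 1); node f is
-- p-lim_n of the elements coded by f n (successor step); the ordinal
-- levels 𝒢^p_α correspond to the ranks of these trees.
data GTree : Set where
  leaf : ℕ → GTree
  node : (ℕ → GTree) → GTree

evalG : Filt → GTree → Filt
evalG p (leaf k) = principal k
evalG p (node f) = lim p (λ n → evalG p (f n))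

InG : Filt → Filt → Set₁
InG p u = Σ GTree λ t → u ≈ evalG p t

Idempotent : Filt → Set₁
Idempotent u = NonPrincipal u × ((u ⊕ u) ≈ u)

{-# OPTIONS --safe #-}
-- If u ^ n ≈ u ^ m with n < m, then v = u ^ n ∈ 𝒢^p lies in the closure of its
-- translates d + v, d ≥ 1 ("Recurrent").  For a recurrent v, every element w of 𝒢^p
-- has a member D that belongs to no translate x + v; for w = v and x = 0 this is
-- absurd.  D is found by induction on the construction of w = p-lim wₙ.
-- Given such Dₙ ∈ wₙ, and sets N_d ∈ w disjoint from their translates by d + 1, the
-- P-point property of p yields S ∈ w, contained in ⋃ Dₙ, which for each d is contained
-- in N_d up to finitely many Dₙ.  So S cannot lie in both x + v and x + (d + 1) + v,
-- whereas, v being recurrent, S ∈ x + v would force this for some d.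
module Submission where

open import Defs
open import Data.Bool as Bool using (Bool; true; false; not)
open import Data.Bool.Properties using (not-¬; ¬-not)
open import Data.Empty using (⊥; ⊥-elim)
open import Data.Nat using (ℕ; zero; suc; _+_; _≤_; _<_; z≤n; s≤s; _<?_; _/_)
open import Data.Nat.DivMod using (m/n≡1+[m∸n]/n)
open import Data.Nat.Properties
  using (+-assoc; +-comm; ≤-refl; m<n⇒m<1+n; m<1+n⇒m<n∨m≡n; ≤∧≢⇒<; ≮⇒≥; <-irrefl; <-cmp;
         m≤m+n; m+n∸m≡n; m≢1+n+m; +-cancelˡ-≡; m≤n⇒∃[o]m+o≡n)
open import Data.Product using (Σ; _×_; _,_; proj₁; proj₂)
open import Data.Sum using (_⊎_; inj₁; inj₂)
open import Data.Unit using (⊤; tt)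
open import Function using (_∘_)
open import Relation.Binary.Definitions using (tri<; tri≈; tri>)
open import Relation.Binary.PropositionalEquality using (_≡_; refl; sym; trans; cong; subst)
open import Relation.Nullary using (¬_; yes; no)

-- Ultrafilters in the weak sense, and limits of them.

-- Constructively, principal filters satisfy `ultra` only for decidable sets;
-- the two last fields are what all elements of 𝒢^p do satisfy.
record IsWeakUltrafilter (u : Filt) : Set₁ where
  field
    upward : ∀ A B → A ⊆ B → u A → u B
    inter  : ∀ A B → u A → u B → u (A ∩ B)
    full   : u (λ _ → ⊤)
    proper : ¬ u (λ _ → ⊥)
    ¬⇒∁    : ∀ A → ¬ u A → u (∁ A)
    colour : (c : ℕ → Bool) → Σ Bool λ b → u (λ x → c x ≡ b)

module WeakUltrafilter {u : Filt} (U : IsWeakUltrafilter u) where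
  open IsWeakUltrafilter U

  map : ∀ {A B} → A ⊆ B → u A → u B
  map = upward _ _

  map₂ : ∀ {A B C : Subset} → (∀ x → A x → B x → C x) → u A → u B → u C
  map₂ f a b = map (λ x (a , b) → f x a b) (inter _ _ a b)

  nonempty : ∀ {A} → u A → ¬ ¬ Σ ℕ A
  nonempty uA ∄A = proper (map (λ x Ax → ∄A (x , Ax)) uA)

  disjoint : ∀ {A B : Subset} → (∀ x → A x → ¬ B x) → u A → ¬ u B
  disjoint dis uA uB = proper (map₂ dis uA uB)

  -- Membership need not be decidable for arbitrary sets; for colour classes it is, and the search
  -- for a first failure below relies on this.
  decide-colour : (c : ℕ → Bool) (b : Bool) → u (λ x → c x ≡ b) ⊎ ¬ u (λ x → c x ≡ b)
  decide-colour c b with colour c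
  ... | b′ , h with b′ Bool.≟ b
  ...   | yes refl = inj₁ h
  ...   | no b′≢b  = inj₂ (disjoint (λ _ e e′ → b′≢b (trans (sym e) e′)) h)

  ⋂< : (P : ℕ → Subset) (k : ℕ) → (∀ j → j < k → u (P j)) → u (λ x → ∀ j → j < k → P j x)
  ⋂< P zero    _ = map (λ _ _ _ ()) full
  ⋂< P (suc k) h = map₂ extend (⋂< P k (λ j j<k → h j (m<n⇒m<1+n j<k))) (h k ≤-refl)
    where
    extend : ∀ x → (∀ j → j < k → P j x) → P k x → ∀ j → j < suc k → P j x
    extend x all Pk j j<1+k with m<1+n⇒m<n∨m≡n j<1+k
    ... | inj₁ j<k  = all j j<k
    ... | inj₂ refl = Pk

open WeakUltrafilter

isWeakUltrafilter : ∀ {u} → IsUltrafilter u → IsWeakUltrafilter u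
isWeakUltrafilter {u} U = record
  { upward = upward ; inter = inter ; full = full ; proper = proper
  ; ¬⇒∁ = ¬⇒∁ ; colour = colour }
  where
  open IsUltrafilter U
  ¬⇒∁ : ∀ A → ¬ u A → u (∁ A)
  ¬⇒∁ A ¬uA with ultra A
  ... | inj₁ uA  = ⊥-elim (¬uA uA)
  ... | inj₂ u∁A = u∁A
  colour : (c : ℕ → Bool) → Σ Bool λ b → u (λ x → c x ≡ b)
  colour c with ultra (λ x → c x ≡ true)
  ... | inj₁ h = true , h
  ... | inj₂ h = false , upward _ _ (λ _ → ¬-not) h

≈-isWeakUltrafilter : ∀ {u v} → u ≈ v → IsWeakUltrafilter v → IsWeakUltrafilter u
≈-isWeakUltrafilter u≈v V = record
  { upward = λ A B A⊆B → from B ∘ V.upward A B A⊆B ∘ to A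
  ; inter  = λ A B uA uB → from _ (V.inter A B (to A uA) (to B uB))
  ; full   = from _ V.full
  ; proper = V.proper ∘ to _
  ; ¬⇒∁    = λ A ¬uA → from _ (V.¬⇒∁ A (¬uA ∘ from A))
  ; colour = λ c → proj₁ (V.colour c) , from _ (proj₂ (V.colour c))
  }
  where
  module V = IsWeakUltrafilter V
  to   = λ A → proj₁ (u≈v A)
  from = λ A → proj₂ (u≈v A)

principal-isWeakUltrafilter : ∀ k → IsWeakUltrafilter (principal k)
principal-isWeakUltrafilter k = record
  { upward = λ A B A⊆B → A⊆B k
  ; inter  = λ A B a b → a , b
  ; full   = tt
  ; proper = λ ()
  ; ¬⇒∁    = λ A ¬Ak → ¬Ak
  ; colour = λ c → c k , refl
  }

lim-isWeakUltrafilter : ∀ {p us} → IsUltrafilter p → (∀ n → IsWeakUltrafilter (us n)) →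
                        IsWeakUltrafilter (lim p us)
lim-isWeakUltrafilter {p} {us} isUltra isWeak = record
  { upward = λ A B A⊆B → map P (λ n → Us.upward n A B A⊆B)
  ; inter  = λ A B → map₂ P (λ n → Us.inter n A B)
  ; full   = map P (λ n _ → Us.full n) (IsUltrafilter.full isUltra)
  ; proper = λ h → IsUltrafilter.proper isUltra (map P (λ n → Us.proper n) h)
  ; ¬⇒∁    = λ A ¬h → map P (λ n → Us.¬⇒∁ n A) (IsWeakUltrafilter.¬⇒∁ P _ ¬h)
  ; colour = colour
  }
  where
  P = isWeakUltrafilter isUltra
  module Us n = IsWeakUltrafilter (isWeak n)
  colour : (c : ℕ → Bool) → Σ Bool λ b → lim p us (λ x → c x ≡ b)
  -- The colours chosen by the `us n` form a colouring of the indices `n`, on which `p` selects one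
  -- value.
  colour c with IsWeakUltrafilter.colour P (λ n → proj₁ (Us.colour n c))
  ... | b , h = b , map P (λ n eq → subst (λ b′ → us n (λ x → c x ≡ b′)) eq (proj₂ (Us.colour n c))) h

evalG-isWeakUltrafilter : ∀ {p} → IsUltrafilter p → ∀ t → IsWeakUltrafilter (evalG p t)
evalG-isWeakUltrafilter P (leaf k) = principal-isWeakUltrafilter k
evalG-isWeakUltrafilter P (node f) =
  lim-isWeakUltrafilter P (λ n → evalG-isWeakUltrafilter P (f n))

-- Closure of 𝒢^p under sums.

shift : ℕ → GTree → GTree
shift k (leaf j) = leaf (k + j)
shift k (node f) = node (λ n → shift k (f n))

graft : GTree → GTree → GTree
graft (leaf k) t = shift k t
graft (node f) t = node (λ n → graft (f n) t)

module _ {p : Filt} (P : IsWeakUltrafilter p) where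

  evalG-shift : ∀ k t → evalG p (shift k t) ≈ (principal k ⊕ evalG p t)
  evalG-shift k (leaf j) A = (λ a → a) , (λ a → a)
  evalG-shift k (node f) A =
    map P (λ n → proj₁ (evalG-shift k (f n) A)) , map P (λ n → proj₂ (evalG-shift k (f n) A))

  -- By definition `⊕` commutes with `p`-limits in its left argument, so only the leaves of `s`
  -- matter; there a principal summand passes through the limits in `t`.
  evalG-graft : ∀ s t → evalG p (graft s t) ≈ (evalG p s ⊕ evalG p t)
  evalG-graft (leaf k) t = evalG-shift k t
  evalG-graft (node f) t A =
    map P (λ n → proj₁ (evalG-graft (f n) t A)) , map P (λ n → proj₂ (evalG-graft (f n) t A))

⊕-InG : ∀ {p u v} → IsUltrafilter p → InG p u → InG p v → InG p (u ⊕ v)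
⊕-InG {p} isUltra (s , u≈s) (t , v≈t) = graft s t , λ A →
  (λ h → proj₂ (evalG-graft P s t A) (map S (λ x → proj₁ (v≈t _)) (proj₁ (u≈s _) h))) ,
  (λ h → proj₂ (u≈s _) (map S (λ x → proj₂ (v≈t _)) (proj₁ (evalG-graft P s t A) h)))
  where
  P = isWeakUltrafilter isUltra
  S = evalG-isWeakUltrafilter isUltra s

^-InG : ∀ {p u} → IsUltrafilter p → InG p u → ∀ n → InG p (u ^ n)
^-InG isUltra u∈G zero    = leaf 0 , λ A → (λ a → a) , (λ a → a)
^-InG isUltra u∈G (suc n) = ⊕-InG isUltra u∈G (^-InG isUltra u∈G n)

InG-isWeakUltrafilter : ∀ {p u} → IsUltrafilter p → InG p u → IsWeakUltrafilter u
InG-isWeakUltrafilter isUltra (t , u≈t) = ≈-isWeakUltrafilter u≈t (evalG-isWeakUltrafilter isUltra t)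

-- Block colourings and the P-point property.

isEven : ℕ → Bool
isEven zero    = true
isEven (suc n) = not (isEven n)

-- Consecutive blocks of length `suc d` alternate in colour, so translation by `suc d` moves each
-- colour class off itself.
blockColour : ℕ → ℕ → Bool
blockColour d y = isEven (y / suc d)

blockColour-shift : ∀ d y → blockColour d (suc d + y) ≡ not (blockColour d y)
blockColour-shift d y = cong isEven (trans (m/n≡1+[m∸n]/n (m≤m+n (suc d) y))
                                           (cong (λ z → suc (z / suc d)) (m+n∸m≡n (suc d) y)))

-- The least d < b with ¬ P d, or b if there is none.
firstFailure : {P : Subset} → (∀ d → P d ⊎ ¬ P d) → ℕ → ℕ
firstFailure P? zero = zero
firstFailure P? (suc b) with P? 0
... | inj₁ _ = suc (firstFailure (P? ∘ suc) b)
... | inj₂ _ = zero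

<firstFailure⇒P : ∀ {P : Subset} (P? : ∀ d → P d ⊎ ¬ P d) b d → d < firstFailure P? b → P d
<firstFailure⇒P P? (suc b) d d< with P? 0
<firstFailure⇒P P? (suc b) zero    d<       | inj₁ P0 = P0
<firstFailure⇒P P? (suc b) (suc d) (s≤s d<) | inj₁ _  = <firstFailure⇒P (P? ∘ suc) b d d<

≤firstFailure : ∀ {P : Subset} (P? : ∀ d → P d ⊎ ¬ P d) b k → k ≤ b → (∀ j → j < k → P j) →
                k ≤ firstFailure P? b
≤firstFailure P? b       zero    _         _ = z≤n
≤firstFailure P? (suc b) (suc k) (s≤s k≤b) h with P? 0
... | inj₁ _   = s≤s (≤firstFailure (P? ∘ suc) b k k≤b (λ j j<k → h (suc j) (s≤s j<k)))
... | inj₂ ¬P0 = ⊥-elim (¬P0 (h 0 (s≤s z≤n)))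

module _ {p : Filt} (sel : Selective p) where
  open Selective sel

  private
    P : IsWeakUltrafilter p
    P = isWeakUltrafilter isUltra

  ≤-large : ∀ k → p (k ≤_)
  ≤-large zero    = map P (λ _ _ → z≤n) (IsWeakUltrafilter.full P)
  ≤-large (suc k) = map₂ P (λ x k≤x x≢k → ≤∧≢⇒< k≤x (x≢k ∘ sym)) (≤-large k)
    (IsWeakUltrafilter.¬⇒∁ P (singleton k) (λ h → nonPrincipal (k , h)))

  -- `h` exceeds every bound on a set in `p`, so none of its fibres is in `p`. Selectivity, applied
  -- to the partition into fibres, then makes `h` injective on some `A` in `p`.
  selective⇒P-point : (Z : ℕ → Subset) → (∀ d n → Z d n ⊎ ¬ Z d n) → (∀ d → p (Z d)) →
    Σ (ℕ → ℕ) λ h → (∀ n d → d < h n → Z d n) ×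
    Σ Subset λ A → p A × (∀ m n → A m → A n → h m ≡ h n → m ≡ n)
  selective⇒P-point Z Z? pZ = h , (λ n → <firstFailure⇒P (λ d → Z? d n) n) , oneToOne
    where
    h : ℕ → ℕ
    -- Capping the search at `n` keeps it finite. The cap is harmless: `p` is nonprincipal, so it
    -- contains every final segment.
    h n = firstFailure (λ d → Z? d n) n

    h-unbounded : ∀ k → p (λ n → k ≤ h n)
    h-unbounded k = map₂ P (λ n → ≤firstFailure (λ d → Z? d n) n k) (≤-large k)
                           (⋂< P Z k (λ j _ → pZ j))

    oneToOne : Σ Subset λ A → p A × (∀ m n → A m → A n → h m ≡ h n → m ≡ n)
    oneToOne with select (λ k n → h n ≡ k) (λ n → h n , refl) (λ _ _ _ e e′ → trans (sym e) e′)
    ... | inj₁ (k , constant) =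
      ⊥-elim (disjoint P (λ n k<h h≡k → <-irrefl (sym h≡k) k<h) (h-unbounded (suc k)) constant)
    ... | inj₂ (A , pA , inj) = A , pA , λ m n Am An e → inj (h n) m n Am e An refl

-- Recurrence and separation.

-- The double negation is what `nonempty` can deliver, and it suffices because recurrence is only
-- used to derive contradictions.
Recurrent : Filt → Set₁
Recurrent v = ∀ A → v A → ¬ ¬ Σ ℕ λ d → v (λ y → A (suc d + y))

-- `¬ v (λ y → D (x + y))` says that D does not belong to the translate x + v.
Separated : Filt → Filt → Set₁
Separated v w = Σ Subset λ D → w D × (∀ x → ¬ v (λ y → D (x + y)))

module _ {v : Filt} (V : IsWeakUltrafilter v) (rec : Recurrent v) where

  -- Otherwise recurrence would put both `x + y ≡ k` and `x + (suc d + y) ≡ k` on sets in `v`, but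
  -- no `y` satisfies both.
  principal-separated : ∀ k → Separated v (principal k)
  principal-separated k = singleton k , refl , λ x h →
    rec _ h λ (d , h′) → disjoint V
      (λ y e e′ → m≢1+n+m y (+-cancelˡ-≡ x _ _ (trans e (sym e′)))) h h′

  module _ {p : Filt} (sel : Selective p) {us : ℕ → Filt}
           (Us : ∀ n → IsWeakUltrafilter (us n)) (separated : ∀ n → Separated v (us n)) where

    private
      P : IsWeakUltrafilter p
      P = isWeakUltrafilter (Selective.isUltra sel)

      D : ℕ → Subset
      D n = proj₁ (separated n)

      colour-of-lim : ∀ d → Σ Bool λ b → lim p us (λ y → blockColour d y ≡ b)
      colour-of-lim d =
        IsWeakUltrafilter.colour (lim-isWeakUltrafilter (Selective.isUltra sel) Us) (blockColour d)

      N : ℕ → Subset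
      N d y = blockColour d y ≡ proj₁ (colour-of-lim d)

      N-shift : ∀ d y → N d y → ¬ N d (suc d + y)
      N-shift d y e e′ = not-¬ (trans e′ (sym e)) (blockColour-shift d y)

      P-point = selective⇒P-point sel (λ d n → us n (N d))
        (λ d n → decide-colour (Us n) (blockColour d) _) (λ d → proj₂ (colour-of-lim d))

    lim-separated : Separated v (lim p us)
    lim-separated with P-point
    ... | h , h-good , A , pA , h-inj = S , map P S-large pA , S-separated
      where
      S : Subset
      S y = Σ ℕ λ n → A n × D n y × (∀ d → d < h n → N d y)

      S-large : ∀ n → A n → us n S
      S-large n An = map₂ (Us n) (λ y Dy Ny → n , An , Dy , Ny) (proj₁ (proj₂ (separated n)))
                                 (⋂< (Us n) N (h n) (h-good n))

      E : ℕ → ℕ → Subset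
      E x j y = Σ ℕ λ n → A n × h n ≡ j × D n (x + y)

      -- As `h` is injective on `A`, a single `n` accounts for all of `E x j`, which therefore lies
      -- in one translate of `D n`; none of these is in `v`.
      E-small : ∀ x j → ¬ v (E x j)
      E-small x j vE = nonempty V vE λ (_ , n , An , hn≡j , _) →
        proj₂ (proj₂ (separated n)) x (map V (λ y (m , Am , hm≡j , Dm) →
          subst (λ i → D i (x + y)) (h-inj m n Am An (trans hm≡j (sym hn≡j))) Dm) vE)

      -- A witness `n` for `x + y` in `S` either has `d < h n`, which gives `N d`, or puts `y` into
      -- one of the `suc d` small sets `E x j` with `j ≤ d`.
      S⇒N : ∀ x d → v (λ y → S (x + y)) → v (λ y → N d (x + y))
      S⇒N x d vS = map₂ V in-N vS
        (⋂< V (λ j → ∁ (E x j)) (suc d) (λ j _ → IsWeakUltrafilter.¬⇒∁ V _ (E-small x j)))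
        where
        in-N : ∀ y → S (x + y) → (∀ j → j < suc d → ¬ E x j y) → N d (x + y)
        in-N y (n , An , Dn , Ny) ∉E with d <? h n
        ... | yes d<h = Ny d d<h
        ... | no  d≮h = ⊥-elim (∉E (h n) (s≤s (≮⇒≥ d≮h)) (n , An , refl , Dn))

      S-separated : ∀ x → ¬ v (λ y → S (x + y))
      S-separated x vS = rec _ vS λ (d , vS′) →
        disjoint V (λ y N₁ N₂ → N-shift d (x + y) N₁ (subst (N d) (comm d y) N₂))
          (S⇒N x d vS)
          (map V (λ y → subst (N d) (+-assoc x (suc d) y))
            -- `S⇒N` holds at every base point; here it is applied at `x + suc d`, where recurrence
            -- provides `S`.
            (S⇒N (x + suc d) d (map V (λ y → subst S (sym (+-assoc x (suc d) y))) vS′)))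
        where
        comm : ∀ d y → x + (suc d + y) ≡ suc d + (x + y)
        comm d y = trans (sym (+-assoc x (suc d) y))
                  (trans (cong (_+ y) (+-comm x (suc d))) (+-assoc (suc d) x y))

  evalG-separated : ∀ {p} → Selective p → ∀ t → Separated v (evalG p t)
  evalG-separated sel (leaf k) = principal-separated k
  evalG-separated sel (node f) = lim-separated sel
    (λ n → evalG-isWeakUltrafilter (Selective.isUltra sel) (f n)) (λ n → evalG-separated sel (f n))

InG⇒¬Recurrent : ∀ {p v} → Selective p → InG p v → ¬ Recurrent v
InG⇒¬Recurrent sel v∈G@(t , v≈t) rec
  with evalG-separated (InG-isWeakUltrafilter (Selective.isUltra sel) v∈G) rec sel t
-- `0 + y` reduces to `y`, so the translate by 0 is `v` itself, which contains `D`.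
... | D , D∈t , ∉v = ∉v 0 (proj₂ (v≈t D) D∈t)

-- Recurrence from coinciding powers.

module _ {u : Filt} (U : IsWeakUltrafilter u) (np : NonPrincipal u) where

  -- A nonprincipal `u` contains the complement of 0; this is what makes the translations positive.
  nonempty-suc : ∀ {A} → u A → ¬ ¬ Σ ℕ (A ∘ suc)
  nonempty-suc uA none =
    nonempty U (IsWeakUltrafilter.inter U _ _ uA
      (IsWeakUltrafilter.¬⇒∁ U (singleton 0) (λ h → np (0 , h))))
    λ { (zero , _ , 0≢0) → 0≢0 refl ; (suc d , a , _) → none (d , a) }

  -- The `suc k` outer summands are peeled off one at a time, each replaced by a positive number
  -- from a set in `u`; these numbers add up to the translation.
  ^-translate : ∀ n → IsWeakUltrafilter (u ^ n) → ∀ k A → (u ^ (suc k + n)) A →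
                ¬ ¬ Σ ℕ λ d → (u ^ n) (λ y → A (suc d + y))
  ^-translate n Uⁿ zero    A h none = nonempty-suc h none
  ^-translate n Uⁿ (suc k) A h none = nonempty-suc h λ (d , h′) →
    ^-translate n Uⁿ k (λ y → A (suc d + y)) h′ λ (d′ , h″) →
      none (d + suc d′ , map Uⁿ (λ y → subst A (sym (+-assoc (suc d) (suc d′) y))) h″)

^-≉ : ∀ {p u} → Selective p → InG p u → NonPrincipal u → ∀ {n m} → n < m → ¬ ((u ^ n) ≈ (u ^ m))
^-≉ {u = u} sel u∈G np {n} n<m uⁿ≈uᵐ with m≤n⇒∃[o]m+o≡n n<m
... | k , refl = InG⇒¬Recurrent sel (^-InG isUltra u∈G n) λ A uⁿA →
  ^-translate (InG-isWeakUltrafilter isUltra u∈G) np n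
    (InG-isWeakUltrafilter isUltra (^-InG isUltra u∈G n)) k A
    (subst (λ i → (u ^ suc i) A) (+-comm n k) (proj₁ (uⁿ≈uᵐ A) uⁿA))
  where open Selective sel using (isUltra)

InG⇒¬Idempotent : ∀ {p u} → Selective p → InG p u → ¬ Idempotent u
InG⇒¬Idempotent sel u∈G (np , u⊕u≈u) = InG⇒¬Recurrent sel u∈G λ A uA →
  nonempty-suc (InG-isWeakUltrafilter (Selective.isUltra sel) u∈G) np (proj₂ (u⊕u≈u A) uA)

theorem3p19 : (p : Filt) → Selective p
    → ((u : Filt) → InG p u → NonPrincipal u
    → (n m : ℕ) → 1 ≤ n → 1 ≤ m
    → ((u ^ n) ≈ (u ^ m) → n ≡ m) × (n ≡ m → (u ^ n) ≈ (u ^ m)))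
    × ((u : Filt) → InG p u → ¬ Idempotent u)
theorem3p19 p sel = (λ u u∈G np n m _ _ → injective u u∈G np n m , λ { refl A → (λ a → a) , (λ a → a) })
                  , λ u → InG⇒¬Idempotent sel
  where
  injective : ∀ u → InG p u → NonPrincipal u → ∀ n m → (u ^ n) ≈ (u ^ m) → n ≡ m
  injective u u∈G np n m uⁿ≈uᵐ with <-cmp n m
  ... | tri< n<m _ _ = ⊥-elim (^-≉ sel u∈G np n<m uⁿ≈uᵐ)
  ... | tri≈ _ n≡m _ = n≡m
  ... | tri> _ _ m<n = ⊥-elim (^-≉ sel u∈G np m<n (λ A → proj₂ (uⁿ≈uᵐ A) , proj₁ (uⁿ≈uᵐ A)))
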